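{- Let $\{z_n\}_{n\ge 0}$ be a sequence of positive numbers satisfying the recurrence $$z_{n+1}=a_nz_{n}+b_nz_{n-1}\qquad (n\ge 1),$$ where $a_n>0$ and $b_n<0$. Assume that $a_{n+1}a_n+b_{n+1}>0$ for $n\geq 1$. For each $n$ let $$f_n(x)=\left[(a_{n+1}a_n+b_{n+1})x+a_{n+1}b_n\right](x-a_{n-1})x^6-b_{n-1}(a_nx+b_n)^4.$$ Suppose there exist two sequences $r(n)$ and $s(n)$ and a positive integer $N$ such that for all $n\geq N$: (i) $r(n)\leq\frac{z_{n}}{z_{n-1}}\leq s(n)\leq a_n$; (ii) $8(a_{n+1}a_n+b_{n+1})r(n)+5(a_{n+1}b_{n}-a_{n-1}a_{n+1}a_n-a_{n-1}b_{n+1})\geq0$ and $a_nr(n)+b_n\geq0$; (iii) $f_n''(r(n))>0$, $f_n'(r(n))>0$ and $f_n(s(n))<0$. Then the ratio sequence $\{z_{n+1}/z_n\}_{n\ge N}$ is ratio log-convex.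
   Context: A sequence $\{x_n\}$ of positive numbers is log-convex if $x_{n-1}x_{n+1}\ge x_n^2$ for all indices $n$ for which the three terms are defined. A sequence $\{x_n\}$ of positive numbers is called ratio log-convex if the sequence $\{x_{n+1}/x_n\}$ is log-convex. -}

module Defs where

open import Level using (_⊔_) renaming (suc to lsuc)
open import Data.Empty using (⊥-elim)
open import Data.List.Base using (List; []; _∷_; map)
open import Data.Nat.Base as ℕ using (ℕ; zero; suc; _∸_)
open import Data.Product.Base using (∃-syntax; _×_; _,_; proj₁; proj₂)
open import Data.Sum.Base using (_⊎_; inj₁; inj₂)
open import Relation.Nullary.Negation using (¬_)
open import Relation.Binary.Core using (Rel)
open import Relation.Binary.Structures using (IsStrictPartialOrder)
open import Algebra.Bundles using (CommutativeRing)
open import Algebra.Apartness.Bundles using (HeytingField; HeytingCommutativeRing)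
import Algebra.Definitions.RawMonoid as RawMonoidDefinitions
import Algebra.Properties.Ring as RingProperties
import Algebra.Apartness.Properties.HeytingCommutativeRing as HeytingProperties

-- Apartness is the same as strict inequality in one of the two directions, so
-- cotransitivity and tightness of _<_ follow from those of _#_.

record OrderedField c ℓ₁ ℓ₂ : Set (lsuc (c ⊔ ℓ₁ ⊔ ℓ₂)) where
  infix 4 _<_ _≤_
  field
    heytingField : HeytingField c ℓ₁ ℓ₂

  open HeytingField heytingField public

  field
    _<_                    : Rel Carrier ℓ₂
    <-isStrictPartialOrder : IsStrictPartialOrder _≈_ _<_
    #⇒<⊎>                  : ∀ {x y} → x # y → x < y ⊎ y < x
    <⇒#                    : ∀ {x y} → x < y → x # y
    +-monoˡ-<              : ∀ {x y} z → x < y → x + z < y + z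
    *-pos                  : ∀ {x y} → 0# < x → 0# < y → 0# < x * y

  _≤_ : Rel Carrier ℓ₂
  x ≤ y = ¬ (y < x)

  open HeytingCommutativeRing heytingCommutativeRing public
    using (commutativeRing)
  open CommutativeRing commutativeRing public using (ring; +-rawMonoid)

  open RawMonoidDefinitions +-rawMonoid using () renaming (_×_ to _·_)

  fromℕ : ℕ → Carrier
  fromℕ n = n · 1#

  -- No absolute value is needed: m and n play symmetric roles.
  IsCauchy : (ℕ → Carrier) → Set (c ⊔ ℓ₂)
  IsCauchy u = ∀ ε → 0# < ε →
    ∃[ M ] (∀ m n → M ℕ.≤ m → M ℕ.≤ n → u m - u n < ε)

  _ConvergesTo_ : (ℕ → Carrier) → Carrier → Set (c ⊔ ℓ₂)
  u ConvergesTo l = ∀ ε → 0# < ε →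
    ∃[ M ] (∀ n → M ℕ.≤ n → (u n - l < ε) × (l - u n < ε))

-- The real numbers, given axiomatically as an Archimedean Cauchy-complete
-- ordered field.  With excluded middle these axioms characterise ℝ up to
-- isomorphism; constructively, the Cauchy reals are a model.

record RealNumbers c ℓ₁ ℓ₂ : Set (lsuc (c ⊔ ℓ₁ ⊔ ℓ₂)) where
  field
    orderedField : OrderedField c ℓ₁ ℓ₂

  open OrderedField orderedField public

  field
    archimedean : ∀ x → ∃[ n ] x < fromℕ n
    complete    : ∀ u → IsCauchy u → ∃[ l ] (u ConvergesTo l)

module Reals {c ℓ₁ ℓ₂} (ℝ : RealNumbers c ℓ₁ ℓ₂) where

  open RealNumbers ℝ
  open RingProperties ring
    using (-‿distribʳ-*; -1*x≈-x; -‿involutive)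
  open HeytingProperties heytingCommutativeRing
    using (x-0≈x; invertibleˡ⇒#)
  open IsStrictPartialOrder <-isStrictPartialOrder
    using (<-respˡ-≈; <-respʳ-≈)
    renaming (irrefl to <-irrefl; trans to <-trans)

  record ℝ⁺ : Set (c ⊔ ℓ₂) where
    constructor _,_
    field
      val : Carrier
      pos : 0# < val

  open ℝ⁺ public

  private
    neg-flip : ∀ {x} → x < 0# → 0# < - x
    neg-flip {x} x<0 = <-respˡ-≈ (-‿inverseʳ x)
      (<-respʳ-≈ (+-identityˡ (- x)) (+-monoˡ-< (- x) x<0))

    -1≮0 : ¬ (0# < - 1#)
    -1≮0 0<-1 = <-irrefl refl (<-trans 0<1 1<0)
      where
      0<1 : 0# < 1#
      0<1 = <-respʳ-≈ (trans (-1*x≈-x (- 1#)) (-‿involutive 1#))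
                      (*-pos 0<-1 0<-1)
      1<0 : 1# < 0#
      1<0 = <-respˡ-≈ (+-identityˡ 1#)
            (<-respʳ-≈ (-‿inverseˡ 1#) (+-monoˡ-< 1# 0<-1))

  inverse : ∀ x → 0# < x → ∃[ y ] x * y ≈ 1#
  inverse x 0<x with #⇒invertible (#-sym (<⇒# 0<x))
  ... | y , _ , [x-0]y≈1 = y , trans (*-congʳ (sym (x-0≈x x))) [x-0]y≈1

  inverse-pos : ∀ {x y} → 0# < x → x * y ≈ 1# → 0# < y
  inverse-pos {x} {y} 0<x xy≈1 with #⇒<⊎> y#0
    where
    y#0 : y # 0#
    y#0 = invertibleˡ⇒# (x , trans (*-congˡ (x-0≈x y)) xy≈1)
  ... | inj₂ 0<y = 0<y
  ... | inj₁ y<0 = ⊥-elim (-1≮0 (<-respʳ-≈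
          (trans (sym (-‿distribʳ-* x y)) (-‿cong xy≈1))
          (*-pos 0<x (neg-flip y<0))))

  infixl 7 _÷_
  _÷_ : ℝ⁺ → ℝ⁺ → ℝ⁺
  (x , 0<x) ÷ (y , 0<y) =
    let (y⁻¹ , yy⁻¹≈1) = inverse y 0<y in
    x * y⁻¹ , *-pos 0<x (inverse-pos 0<y yy⁻¹≈1)

  -- The sequence {x_n}_{n ≥ N}, reindexed to start at 0.
  from : ℕ → (ℕ → ℝ⁺) → (ℕ → ℝ⁺)
  from N x n = x (N ℕ.+ n)

  ratios : (ℕ → ℝ⁺) → (ℕ → ℝ⁺)
  ratios x n = x (suc n) ÷ x n

  LogConvex : (ℕ → ℝ⁺) → Set ℓ₂
  LogConvex x = ∀ n → 1 ℕ.≤ n →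
    val (x n) * val (x n) ≤ val (x (n ∸ 1)) * val (x (suc n))

  RatioLogConvex : (ℕ → ℝ⁺) → Set ℓ₂
  RatioLogConvex x = LogConvex (ratios x)

  -- Coefficients in ascending degree.
  Polynomial : Set c
  Polynomial = List Carrier

  infixl 6 _⊕_ _⊖_
  infixl 7 _⊗_
  infixr 8 _↑_

  con : Carrier → Polynomial
  con k = k ∷ []

  X : Polynomial
  X = 0# ∷ 1# ∷ []

  _⊕_ : Polynomial → Polynomial → Polynomial
  []      ⊕ q       = q
  (k ∷ p) ⊕ []      = k ∷ p
  (k ∷ p) ⊕ (l ∷ q) = k + l ∷ p ⊕ q

  _⊖_ : Polynomial → Polynomial → Polynomial
  p ⊖ q = p ⊕ map -_ q

  _⊗_ : Polynomial → Polynomial → Polynomial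
  []      ⊗ q = []
  (k ∷ p) ⊗ q = map (k *_) q ⊕ (0# ∷ p ⊗ q)

  _↑_ : Polynomial → ℕ → Polynomial
  p ↑ zero  = con 1#
  p ↑ suc n = p ⊗ p ↑ n

  -- (k + X p)′ = p + X p′
  infix 9 _′
  _′ : Polynomial → Polynomial
  []      ′ = []
  (k ∷ p) ′ = p ⊕ (0# ∷ p ′)

  eval : Polynomial → Carrier → Carrier
  eval []      x = 0#
  eval (k ∷ p) x = k + x * eval p x

  -- Only used for n ≥ 1, so that n ∸ 1 is the true predecessor.
  f : (a b : ℕ → Carrier) → ℕ → Polynomial
  f a b n =
    (con (a (suc n) * a n + b (suc n)) ⊗ X ⊕ con (a (suc n) * b n))
      ⊗ (X ⊖ con (a (n ∸ 1))) ⊗ X ↑ 6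
    ⊖ con (b (n ∸ 1)) ⊗ (con (a n) ⊗ X ⊕ con (b n)) ↑ 4

{-# OPTIONS --safe #-}
module Submission where

open import Defs
open import Level using (Level)
open import Algebra.Bundles using (CommutativeRing)
open import Algebra.Core using (Op₂)
open import Data.Fin using () renaming (#_ to fin)
open import Data.List.Base using (List; []; _∷_; map)
open import Data.List.Relation.Unary.All using (All; []; _∷_)
open import Data.Nat.Base as ℕ using (ℕ; zero; suc; _∸_)
import Data.Nat.Properties as ℕ
open import Data.Product.Base using (_,_; proj₁; proj₂)
open import Data.Sum.Base using (inj₁; inj₂)
open import Data.Vec.Base using (Vec; []; _∷_)
open import Function.Base using (_∘_)
open import Relation.Binary.Bundles using (Setoid)
open import Relation.Binary.Structures using (IsStrictPartialOrder)
import Algebra.Apartness.Properties.HeytingCommutativeRing as HeytingProperties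
import Algebra.Properties.Group as GroupProperties
import Algebra.Properties.Ring as RingProperties
import Algebra.Properties.Semiring.Exp as Exp
import Algebra.Solver.Ring.NaturalCoefficients.Default as SemiringSolver
import Relation.Binary.Reasoning.Setoid as ≈-Reasoning

-- Let v, u, p, q be four consecutive ratios, u = z_n / z_{n-1}.  The recurrence
-- gives f_n(u) v = b_{n-1} p u⁴ (q u³ - p³ v), so, as b_{n-1} < 0, ratio
-- log-convexity p³ v ≤ q u³ amounts to f_n(u) ≤ 0.  At r(n) > 0 the Taylor
-- coefficients of f_n of order 1 and 2 are positive by (iii), and those of order
-- 3 to 8 are nonnegative by (ii) and the signs of a and b.  Hence f_n increases
-- on [r(n), ∞), and f_n(u) ≤ f_n(s(n)) < 0.

-- Order arithmetic in a constructive ordered field.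

module OrderedFieldProperties {c ℓ₁ ℓ₂} (F : OrderedField c ℓ₁ ℓ₂) where

  open OrderedField F
  open CommutativeRing commutativeRing using (+-group; semiring)
  open HeytingProperties heytingCommutativeRing
  open RingProperties ring
    using (-‿distribˡ-*; -‿distribʳ-*; -‿involutive)
  open GroupProperties +-group using (//-rightDividesˡ; //-rightDividesʳ)
  open Exp semiring using (_^_)
  open IsStrictPartialOrder <-isStrictPartialOrder public
    using (<-respˡ-≈; <-respʳ-≈)
    renaming (irrefl to <-irrefl; trans to <-trans; asym to <-asym)

  <⇒≤ : ∀ {x y} → x < y → x ≤ y
  <⇒≤ = <-asym

  ≤-reflexive : ∀ {x y} → x ≈ y → x ≤ y
  ≤-reflexive x≈y = <-irrefl (sym x≈y)

  -- Since `≤` is a negated `<`, the task is to refute z < x. Cotransitivity puts y apart from z or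
  -- from x, and each resulting strict order contradicts a hypothesis, directly or after chaining
  -- with z < x.
  ≤-trans : ∀ {x y z} → x ≤ y → y ≤ z → x ≤ z
  ≤-trans {y = y} x≤y y≤z z<x with #-cotrans (<⇒# z<x) y
  ... | inj₁ z#y with #⇒<⊎> z#y
  ...   | inj₁ z<y = y≤z z<y
  ...   | inj₂ y<z = x≤y (<-trans y<z z<x)
  ≤-trans {y = y} x≤y y≤z z<x | inj₂ y#x with #⇒<⊎> y#x
  ...   | inj₁ y<x = x≤y y<x
  ...   | inj₂ x<y = y≤z (<-trans z<x x<y)

  ≤-respˡ-≈ : ∀ {x y z} → x ≈ y → x ≤ z → y ≤ z
  ≤-respˡ-≈ x≈y x≤z = x≤z ∘ <-respʳ-≈ (sym x≈y)

  ≤-respʳ-≈ : ∀ {x y z} → x ≈ y → z ≤ x → z ≤ y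
  ≤-respʳ-≈ x≈y z≤x = z≤x ∘ <-respˡ-≈ (sym x≈y)

  x+y-y≈x : ∀ x y → x + y - y ≈ x
  x+y-y≈x x y = //-rightDividesʳ y x

  x-y+y≈x : ∀ x y → x - y + y ≈ x
  x-y+y≈x x y = //-rightDividesˡ y x

  +-cancelʳ-< : ∀ z {x y} → x + z < y + z → x < y
  +-cancelʳ-< z {x} {y} p =
    <-respˡ-≈ (x+y-y≈x x z) (<-respʳ-≈ (x+y-y≈x y z) (+-monoˡ-< (- z) p))

  +-monoˡ-≤ : ∀ z {x y} → x ≤ y → x + z ≤ y + z
  +-monoˡ-≤ z x≤y = x≤y ∘ +-cancelʳ-< z

  +-monoʳ-≤ : ∀ z {x y} → x ≤ y → z + x ≤ z + y
  +-monoʳ-≤ z {x} {y} x≤y =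
    ≤-respˡ-≈ (+-comm x z) (≤-respʳ-≈ (+-comm y z) (+-monoˡ-≤ z x≤y))

  +-nonneg : ∀ {x y} → 0# ≤ x → 0# ≤ y → 0# ≤ x + y
  +-nonneg {x} {y} 0≤x 0≤y =
    ≤-trans 0≤y (≤-respˡ-≈ (+-identityˡ y) (+-monoˡ-≤ y 0≤x))

  x<y⇒0<y-x : ∀ {x y} → x < y → 0# < y - x
  x<y⇒0<y-x {x} x<y = <-respˡ-≈ (-‿inverseʳ x) (+-monoˡ-< (- x) x<y)

  0<y-x⇒x<y : ∀ {x y} → 0# < y - x → x < y
  0<y-x⇒x<y {x} {y} p =
    <-respˡ-≈ (+-identityˡ x) (<-respʳ-≈ (x-y+y≈x y x) (+-monoˡ-< x p))

  x<y⇒x-y<0 : ∀ {x y} → x < y → x - y < 0#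
  x<y⇒x-y<0 {y = y} x<y = <-respʳ-≈ (-‿inverseʳ y) (+-monoˡ-< (- y) x<y)

  x≤y⇒0≤y-x : ∀ {x y} → x ≤ y → 0# ≤ y - x
  x≤y⇒0≤y-x {x} x≤y = ≤-respˡ-≈ (-‿inverseʳ x) (+-monoˡ-≤ (- x) x≤y)

  0≤y-x⇒x≤y : ∀ {x y} → 0# ≤ y - x → x ≤ y
  0≤y-x⇒x≤y {x} {y} p =
    ≤-respˡ-≈ (+-identityˡ x) (≤-respʳ-≈ (x-y+y≈x y x) (+-monoˡ-≤ x p))

  neg-pos : ∀ {x} → x < 0# → 0# < - x
  neg-pos {x} x<0 = <-respʳ-≈ (+-identityˡ (- x)) (x<y⇒0<y-x x<0)

  *-distribʳ-- : ∀ x y z → (y - x) * z ≈ y * z - x * z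
  *-distribʳ-- x y z =
    trans (distribʳ z y (- x)) (+-congˡ (sym (-‿distribˡ-* x z)))

  *-monoˡ-< : ∀ {x y z} → 0# < z → x < y → x * z < y * z
  *-monoˡ-< {x} {y} {z} 0<z x<y =
    0<y-x⇒x<y (<-respʳ-≈ (*-distribʳ-- x y z) (*-pos (x<y⇒0<y-x x<y) 0<z))

  *-monoʳ-< : ∀ {x y z} → 0# < z → x < y → z * x < z * y
  *-monoʳ-< {x} {y} {z} 0<z x<y =
    <-respˡ-≈ (*-comm x z) (<-respʳ-≈ (*-comm y z) (*-monoˡ-< 0<z x<y))

  *-pos-neg : ∀ {x y} → 0# < x → y < 0# → x * y < 0#
  *-pos-neg {x} 0<x y<0 = <-respʳ-≈ (zeroʳ x) (*-monoʳ-< 0<x y<0)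

  *-neg-neg : ∀ {x y} → x < 0# → y < 0# → 0# < x * y
  *-neg-neg {x} {y} x<0 y<0 = <-respʳ-≈ (begin
    - x * - y      ≈⟨ -‿distribˡ-* x (- y) ⟨
    - (x * - y)    ≈⟨ -‿cong (-‿distribʳ-* x y) ⟨
    - (- (x * y))  ≈⟨ -‿involutive (x * y) ⟩
    x * y          ∎) (*-pos (neg-pos x<0) (neg-pos y<0))
    where open ≈-Reasoning setoid

  -- If w inverts x y, then y w inverts x, and invertible elements are apart from zero.
  x*y#0⇒x#0 : ∀ {x y} → x * y # 0# → x # 0#
  x*y#0⇒x#0 {x} {y} xy#0 with #⇒invertible xy#0
  ... | w , _ , [xy-0]w≈1 = invertibleʳ⇒# (y * w , (begin
    (x - 0#) * (y * w)  ≈⟨ *-congʳ (x-0≈x x) ⟩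
    x * (y * w)         ≈⟨ *-assoc x y w ⟨
    x * y * w           ≈⟨ *-congʳ (x-0≈x (x * y)) ⟨
    (x * y - 0#) * w    ≈⟨ [xy-0]w≈1 ⟩
    1#                  ∎))
    where open ≈-Reasoning setoid

  -- Signs of x and y are not decidable in general, but x y < 0 forces both factors apart from zero;
  -- then their signs can be compared, and every case is contradictory.
  *-nonneg : ∀ {x y} → 0# ≤ x → 0# ≤ y → 0# ≤ x * y
  *-nonneg {x} {y} 0≤x 0≤y xy<0
    with #⇒<⊎> (x*y#0⇒x#0 (<⇒# xy<0))
       | #⇒<⊎> (x*y#0⇒x#0 (#-congʳ (*-comm x y) (<⇒# xy<0)))
  ... | inj₁ x<0 | _        = 0≤x x<0
  ... | inj₂ _   | inj₁ y<0 = 0≤y y<0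
  ... | inj₂ 0<x | inj₂ 0<y = <-asym xy<0 (*-pos 0<x 0<y)

  *-monoˡ-≤ : ∀ {x y z} → 0# ≤ z → x ≤ y → x * z ≤ y * z
  *-monoˡ-≤ {x} {y} {z} 0≤z x≤y =
    0≤y-x⇒x≤y (≤-respʳ-≈ (*-distribʳ-- x y z) (*-nonneg (x≤y⇒0≤y-x x≤y) 0≤z))

  *-monoʳ-≤ : ∀ {x y z} → 0# ≤ z → x ≤ y → z * x ≤ z * y
  *-monoʳ-≤ {x} {y} {z} 0≤z x≤y =
    ≤-respˡ-≈ (*-comm x z) (≤-respʳ-≈ (*-comm y z) (*-monoˡ-≤ 0≤z x≤y))

  0<1 : 0# < 1#
  0<1 with #⇒<⊎> 1#0
  ... | inj₂ 0<1 = 0<1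
  ... | inj₁ 1<0 = <-respʳ-≈ (*-identityˡ 1#) (*-neg-neg 1<0 1<0)

  fromℕ-nonneg : ∀ n → 0# ≤ fromℕ n
  fromℕ-nonneg zero    = ≤-reflexive refl
  fromℕ-nonneg (suc n) = +-nonneg (<⇒≤ 0<1) (fromℕ-nonneg n)

  fromℕ-pos : ∀ n → 0# < fromℕ (suc n)
  fromℕ-pos zero    = <-respʳ-≈ (sym (+-identityʳ 1#)) 0<1
  fromℕ-pos (suc n) = <-trans (fromℕ-pos n)
    (<-respˡ-≈ (+-identityˡ _) (+-monoˡ-< (fromℕ (suc n)) 0<1))

  ^-pos : ∀ {x} n → 0# < x → 0# < x ^ n
  ^-pos zero    0<x = 0<1
  ^-pos (suc n) 0<x = *-pos 0<x (^-pos n 0<x)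

  ^-nonneg : ∀ {x} n → 0# ≤ x → 0# ≤ x ^ n
  ^-nonneg zero    0≤x = <⇒≤ 0<1
  ^-nonneg (suc n) 0≤x = *-nonneg 0≤x (^-nonneg n 0≤x)

  *-cancelʳ-≤ : ∀ {x y z} → 0# < z → x * z ≤ y * z → x ≤ y
  *-cancelʳ-≤ 0<z xz≤yz = xz≤yz ∘ *-monoˡ-< 0<z

  *-cancelˡ-≤ : ∀ {x y z} → 0# < z → z * x ≤ z * y → x ≤ y
  *-cancelˡ-≤ 0<z zx≤zy = zx≤zy ∘ *-monoʳ-< 0<z

-- A jet records the value, the derivative and the second derivative (not
-- divided by 2!) of a function at a point.
record Jet {c : Level} (A : Set c) : Set c where
  constructor jet
  field
    at₀ at₁ at₂ : A

open Jet

-- The operations are kept generic so that the same expression can be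
-- read both in the field and in the syntax of the semiring solver.
module JetArithmetic {c} {S : Set c} (_+_ _*_ : Op₂ S) (0# 1# : S) where

  infixl 6 _⊞_
  infixl 7 _⊠_
  infixr 8 _^ᴶ_

  constant : S → Jet S
  constant k = jet k 0# 0#

  identity : S → Jet S
  identity x = jet x 1# 0#

  _⊞_ : Op₂ (Jet S)
  jet p p₁ p₂ ⊞ jet q q₁ q₂ = jet (p + q) (p₁ + q₁) (p₂ + q₂)

  _⊠_ : Op₂ (Jet S)
  jet p p₁ p₂ ⊠ jet q q₁ q₂ =
    jet (p * q)
        ((p₁ * q) + (p * q₁))
        ((p₂ * q) + (((1# + 1#) * (p₁ * q₁)) + (p * q₂)))

  _^ᴶ_ : Jet S → ℕ → Jet S
  p ^ᴶ zero  = constant 1#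
  p ^ᴶ suc n = p ⊠ p ^ᴶ n

  -- ε stands for - 1#: the semiring solver has no subtraction.
  fᴶ : (ε A C α β a b x : S) → Jet S
  fᴶ ε A C α β a b x =
    (constant A ⊠ identity x ⊞ constant C)
      ⊠ (identity x ⊞ constant ε ⊠ constant α) ⊠ identity x ^ᴶ 6
    ⊞ constant ε ⊠ (constant β ⊠ (constant a ⊠ identity x ⊞ constant b) ^ᴶ 4)

-- With D = C - α A and E = 8 A r + 5 D, these are the coefficients of t³, …, t⁸
-- in 10 f (r + t), where G = - C α, B = - β and L = a r + b.  The factor 10
-- clears the denominators that arise when D is eliminated in favour of E.
module TaylorCoefficients {c} {S : Set c}
  (_+_ _*_ : Op₂ S) (_^_ : S → ℕ → S) (ν : ℕ → S) where

  private
    infixl 6 _⊹_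
    infixl 7 _∙_
    infixr 8 _↗_
    _⊹_ = _+_
    _∙_ = _*_
    _↗_ = _^_

  higherCoefficients : (E A G B a L r : S) → List S
  higherCoefficients E A G B a L r =
    ν 70 ∙ r ↗ 4 ∙ E ⊹ ν 200 ∙ G ∙ r ↗ 3 ⊹ ν 40 ∙ B ∙ a ↗ 3 ∙ L ∷
    ν 70 ∙ r ↗ 3 ∙ (E ⊹ ν 2 ∙ A ∙ r) ⊹ ν 150 ∙ G ∙ r ↗ 2 ⊹ ν 10 ∙ B ∙ a ↗ 4 ∷
    ν 42 ∙ r ↗ 2 ∙ E ⊹ ν 224 ∙ A ∙ r ↗ 3 ⊹ ν 60 ∙ G ∙ r ∷
    ν 14 ∙ r ∙ E ⊹ ν 168 ∙ A ∙ r ↗ 2 ⊹ ν 10 ∙ G ∷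
    ν 2 ∙ E ⊹ ν 64 ∙ A ∙ r ∷
    ν 10 ∙ A ∷ []

-- Formal derivatives of polynomials, computed with jets.

module Derivatives {c ℓ₁ ℓ₂} (ℝ : RealNumbers c ℓ₁ ℓ₂) where

  open RealNumbers ℝ
  open Reals ℝ
  open OrderedFieldProperties orderedField
  open CommutativeRing commutativeRing using (commutativeSemiring; semiring)
  open RingProperties ring using (-1*x≈-x)
  open SemiringSolver commutativeSemiring
    using ( solve; prove; var; ⟦_⟧; ⟦_⟧↓
          ; _:=_; _:+_; _:*_; _:^_; _:×_ )
    renaming (con to :con; Polynomial to Expr)
  open JetArithmetic _+_ _*_ 0# 1#

  :0 :1 : ∀ {n} → Expr n
  :0 = :con 0
  :1 = :con 1

  module _ {n : ℕ} where
    open JetArithmetic {S = Expr n} _:+_ _:*_ :0 :1 public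
      renaming ( constant to :constant; identity to :identity
               ; _⊞_ to infixl 6 _:⊞_; _⊠_ to infixl 7 _:⊠_; fᴶ to :fᴶ )
      hiding (_^ᴶ_)

  infix 4 _≈ᴶ_

  record _≈ᴶ_ (p q : Jet Carrier) : Set ℓ₁ where
    constructor jet
    field
      ≈₀ : at₀ p ≈ at₀ q
      ≈₁ : at₁ p ≈ at₁ q
      ≈₂ : at₂ p ≈ at₂ q

  open _≈ᴶ_

  jetSetoid : Setoid c ℓ₁
  jetSetoid = record
    { _≈_           = _≈ᴶ_
    ; isEquivalence = record
      { refl  = jet refl refl refl
      ; sym   = λ (jet e e₁ e₂) → jet (sym e) (sym e₁) (sym e₂)
      ; trans = λ (jet e e₁ e₂) (jet e′ e₁′ e₂′) →
          jet (trans e e′) (trans e₁ e₁′) (trans e₂ e₂′)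
      }
    }

  open Setoid jetSetoid using () renaming (refl to reflᴶ; trans to transᴶ)

  ⊞-cong : ∀ {p p′ q q′} → p ≈ᴶ p′ → q ≈ᴶ q′ → p ⊞ q ≈ᴶ p′ ⊞ q′
  ⊞-cong (jet e e₁ e₂) (jet e′ e₁′ e₂′) =
    jet (+-cong e e′) (+-cong e₁ e₁′) (+-cong e₂ e₂′)

  ⊠-cong : ∀ {p p′ q q′} → p ≈ᴶ p′ → q ≈ᴶ q′ → p ⊠ q ≈ᴶ p′ ⊠ q′
  ⊠-cong (jet e e₁ e₂) (jet e′ e₁′ e₂′) =
    jet (*-cong e e′)
        (+-cong (*-cong e₁ e′) (*-cong e e₁′))
        (+-cong (*-cong e₂ e′) (+-cong (*-congˡ (*-cong e₁ e₁′)) (*-cong e e₂′)))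

  eval-congʳ : ∀ p {x y} → x ≈ y → eval p x ≈ eval p y
  eval-congʳ []      x≈y = refl
  eval-congʳ (k ∷ p) x≈y = +-congˡ (*-cong x≈y (eval-congʳ p x≈y))

  module ≈ᴶ-Reasoning = ≈-Reasoning jetSetoid

  ⟦_⟧ᴶ : ∀ {n} → Jet (Expr n) → Vec Carrier n → Jet Carrier
  ⟦ jet e e₁ e₂ ⟧ᴶ ρ = jet (⟦ e ⟧ ρ) (⟦ e₁ ⟧ ρ) (⟦ e₂ ⟧ ρ)

  -- The solver proves one equation at a time, so a jet identity is split into its components. Each
  -- hypothesis compares normal forms, which `refl` settles.
  solveᴶ : ∀ {n} (ρ : Vec Carrier n) (e e′ : Jet (Expr n)) →
    ⟦ at₀ e ⟧↓ ρ ≈ ⟦ at₀ e′ ⟧↓ ρ →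
    ⟦ at₁ e ⟧↓ ρ ≈ ⟦ at₁ e′ ⟧↓ ρ →
    ⟦ at₂ e ⟧↓ ρ ≈ ⟦ at₂ e′ ⟧↓ ρ →
    ⟦ e ⟧ᴶ ρ ≈ᴶ ⟦ e′ ⟧ᴶ ρ
  solveᴶ ρ (jet e e₁ e₂) (jet e′ e₁′ e₂′) h h₁ h₂ =
    jet (prove ρ e e′ h) (prove ρ e₁ e₁′ h₁) (prove ρ e₂ e₂′ h₂)

  module _ (x : Carrier) where

    -- Bridge from formal derivatives to jets. It is shown below to respect every polynomial
    -- operation, which for products is the Leibniz rule up to order two.
    jetOf : Polynomial → Jet Carrier
    jetOf p = jet (eval p x) (eval (p ′) x) (eval (p ′ ′) x)

    eval-⊕ : ∀ p q → eval (p ⊕ q) x ≈ eval p x + eval q x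
    eval-⊕ []      q       = sym (+-identityˡ _)
    eval-⊕ (k ∷ p) []      = sym (+-identityʳ _)
    eval-⊕ (k ∷ p) (l ∷ q) = trans (+-congˡ (*-congˡ (eval-⊕ p q)))
      (solve 5 (λ k l x p q → (k :+ l) :+ x :* (p :+ q)
                           := (k :+ x :* p) :+ (l :+ x :* q))
        refl k l x (eval p x) (eval q x))

    eval-∷′ : ∀ k p → eval ((k ∷ p) ′) x ≈ eval p x + x * eval (p ′) x
    eval-∷′ k p = trans (eval-⊕ p (0# ∷ p ′)) (+-congˡ (+-identityˡ _))

    eval-⊕′ : ∀ p q → eval ((p ⊕ q) ′) x ≈ eval (p ′) x + eval (q ′) x
    eval-⊕′ []      q       = sym (+-identityˡ _)
    eval-⊕′ (k ∷ p) []      = sym (+-identityʳ _)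
    eval-⊕′ (k ∷ p) (l ∷ q) = begin
      eval ((k + l ∷ p ⊕ q) ′) x
        ≈⟨ eval-∷′ (k + l) (p ⊕ q) ⟩
      eval (p ⊕ q) x + x * eval ((p ⊕ q) ′) x
        ≈⟨ +-cong (eval-⊕ p q) (*-congˡ (eval-⊕′ p q)) ⟩
      (eval p x + eval q x) + x * (eval (p ′) x + eval (q ′) x)
        ≈⟨ solve 5 (λ x p q p₁ q₁ → (p :+ q) :+ x :* (p₁ :+ q₁)
                                 := (p :+ x :* p₁) :+ (q :+ x :* q₁))
             refl x (eval p x) (eval q x) (eval (p ′) x) (eval (q ′) x) ⟩
      (eval p x + x * eval (p ′) x) + (eval q x + x * eval (q ′) x)
        ≈⟨ +-cong (eval-∷′ k p) (eval-∷′ l q) ⟨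
      eval ((k ∷ p) ′) x + eval ((l ∷ q) ′) x ∎
      where open ≈-Reasoning setoid

    eval-∷′′ : ∀ k p →
      eval ((k ∷ p) ′ ′) x ≈ eval (p ′) x + (eval (p ′) x + x * eval (p ′ ′) x)
    eval-∷′′ k p =
      trans (eval-⊕′ p (0# ∷ p ′)) (+-congˡ (eval-∷′ 0# (p ′)))

    -- The Horner step k + X p in jet arithmetic. It drives the inductions on coefficient lists that
    -- follow.
    jetOf-∷ : ∀ k p → jetOf (k ∷ p) ≈ᴶ constant k ⊞ identity x ⊠ jetOf p
    jetOf-∷ k p = jet refl
      (trans (eval-∷′ k p)
        (solve 3 (λ x p p₁ → p :+ x :* p₁ := :0 :+ (:1 :* p :+ x :* p₁))
          refl x (eval p x) (eval (p ′) x)))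
      (trans (eval-∷′′ k p)
        (solve 4 (λ x p p₁ p₂ → p₁ :+ (p₁ :+ x :* p₂)
            := :0 :+ (:0 :* p :+ ((:1 :+ :1) :* (:1 :* p₁) :+ x :* p₂)))
          refl x (eval p x) (eval (p ′) x) (eval (p ′ ′) x)))

    private
      :k :l :x : Expr 9
      :k = var (fin 0)
      :l = var (fin 1)
      :x = var (fin 2)

      :p :q : Jet (Expr 9)
      :p = jet (var (fin 3)) (var (fin 4)) (var (fin 5))
      :q = jet (var (fin 6)) (var (fin 7)) (var (fin 8))

      -- One environment serves all solver calls below; slots that an identity does not mention are
      -- filled with arbitrary values.
      env : Carrier → Carrier → Jet Carrier → Jet Carrier → Vec Carrier 9
      env k l (jet p p₁ p₂) (jet q q₁ q₂) =
        k ∷ l ∷ x ∷ p ∷ p₁ ∷ p₂ ∷ q ∷ q₁ ∷ q₂ ∷ []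

    jetOf-⊕ : ∀ p q → jetOf (p ⊕ q) ≈ᴶ jetOf p ⊞ jetOf q
    jetOf-⊕ []      q       =
      jet (sym (+-identityˡ _)) (sym (+-identityˡ _)) (sym (+-identityˡ _))
    jetOf-⊕ (k ∷ p) []      =
      jet (sym (+-identityʳ _)) (sym (+-identityʳ _)) (sym (+-identityʳ _))
    jetOf-⊕ (k ∷ p) (l ∷ q) = begin
      jetOf (k + l ∷ p ⊕ q)
        ≈⟨ jetOf-∷ (k + l) (p ⊕ q) ⟩
      constant (k + l) ⊞ identity x ⊠ jetOf (p ⊕ q)
        ≈⟨ ⊞-cong reflᴶ (⊠-cong reflᴶ (jetOf-⊕ p q)) ⟩
      constant (k + l) ⊞ identity x ⊠ (jetOf p ⊞ jetOf q)
        ≈⟨ solveᴶ (env k l (jetOf p) (jetOf q))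
             (:constant (:k :+ :l) :⊞ :identity :x :⊠ (:p :⊞ :q))
             ((:constant :k :⊞ :identity :x :⊠ :p)
               :⊞ (:constant :l :⊞ :identity :x :⊠ :q))
             refl refl refl ⟩
      (constant k ⊞ identity x ⊠ jetOf p) ⊞ (constant l ⊞ identity x ⊠ jetOf q)
        ≈⟨ ⊞-cong (jetOf-∷ k p) (jetOf-∷ l q) ⟨
      jetOf (k ∷ p) ⊞ jetOf (l ∷ q) ∎
      where open ≈ᴶ-Reasoning

    -- Stated for any g that agrees with multiplication by k up to `≈`, so that it covers both the
    -- scaling in `⊗` and the negation in `⊖`, where k is -1.
    jetOf-map : ∀ k g → (∀ y → g y ≈ k * y) →
      ∀ p → jetOf (map g p) ≈ᴶ constant k ⊠ jetOf p
    jetOf-map k g g≈k* [] =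
      solveᴶ (env k k (jetOf []) (jetOf []))
        (:constant :0) (:constant :k :⊠ :constant :0)
        refl refl refl
    jetOf-map k g g≈k* (l ∷ p) = begin
      jetOf (g l ∷ map g p)
        ≈⟨ jetOf-∷ (g l) (map g p) ⟩
      constant (g l) ⊞ identity x ⊠ jetOf (map g p)
        ≈⟨ ⊞-cong (jet (g≈k* l) refl refl)
                  (⊠-cong reflᴶ (jetOf-map k g g≈k* p)) ⟩
      constant (k * l) ⊞ identity x ⊠ (constant k ⊠ jetOf p)
        ≈⟨ solveᴶ (env k l (jetOf p) (jetOf p))
             (:constant (:k :* :l) :⊞ :identity :x :⊠ (:constant :k :⊠ :p))
             (:constant :k :⊠ (:constant :l :⊞ :identity :x :⊠ :p))
             refl refl refl ⟩
      constant k ⊠ (constant l ⊞ identity x ⊠ jetOf p)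
        ≈⟨ ⊠-cong reflᴶ (jetOf-∷ l p) ⟨
      constant k ⊠ jetOf (l ∷ p) ∎
      where open ≈ᴶ-Reasoning

    -- After a Horner step on p, the Leibniz rule reduces to distributivity and associativity of jet
    -- arithmetic, checked componentwise.
    jetOf-⊗ : ∀ p q → jetOf (p ⊗ q) ≈ᴶ jetOf p ⊠ jetOf q
    jetOf-⊗ [] q =
      solveᴶ (env 0# 0# (jetOf []) (jetOf q)) (:constant :0) (:constant :0 :⊠ :q)
        refl refl refl
    jetOf-⊗ (k ∷ p) q = begin
      jetOf (map (k *_) q ⊕ (0# ∷ p ⊗ q))
        ≈⟨ jetOf-⊕ (map (k *_) q) (0# ∷ p ⊗ q) ⟩
      jetOf (map (k *_) q) ⊞ jetOf (0# ∷ p ⊗ q)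
        ≈⟨ ⊞-cong (jetOf-map k (k *_) (λ _ → refl) q) (jetOf-∷ 0# (p ⊗ q)) ⟩
      constant k ⊠ jetOf q ⊞ (constant 0# ⊞ identity x ⊠ jetOf (p ⊗ q))
        ≈⟨ ⊞-cong reflᴶ (⊞-cong reflᴶ (⊠-cong reflᴶ (jetOf-⊗ p q))) ⟩
      constant k ⊠ jetOf q ⊞ (constant 0# ⊞ identity x ⊠ (jetOf p ⊠ jetOf q))
        ≈⟨ solveᴶ (env k 0# (jetOf p) (jetOf q))
             (:constant :k :⊠ :q
               :⊞ (:constant :0 :⊞ :identity :x :⊠ (:p :⊠ :q)))
             ((:constant :k :⊞ :identity :x :⊠ :p) :⊠ :q)
             refl refl refl ⟩
      (constant k ⊞ identity x ⊠ jetOf p) ⊠ jetOf q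
        ≈⟨ ⊠-cong (jetOf-∷ k p) reflᴶ ⟨
      jetOf (k ∷ p) ⊠ jetOf q ∎
      where open ≈ᴶ-Reasoning

    jetOf-con : ∀ k → jetOf (con k) ≈ᴶ constant k
    jetOf-con k = begin
      jetOf (con k)
        ≈⟨ jetOf-∷ k [] ⟩
      constant k ⊞ identity x ⊠ constant 0#
        ≈⟨ solveᴶ (env k k (jetOf []) (jetOf []))
             (:constant :k :⊞ :identity :x :⊠ :constant :0) (:constant :k)
             refl refl refl ⟩
      constant k ∎
      where open ≈ᴶ-Reasoning

    jetOf-X : jetOf X ≈ᴶ identity x
    jetOf-X = begin
      jetOf X
        ≈⟨ jetOf-∷ 0# (con 1#) ⟩
      constant 0# ⊞ identity x ⊠ jetOf (con 1#)
        ≈⟨ ⊞-cong reflᴶ (⊠-cong reflᴶ (jetOf-con 1#)) ⟩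
      constant 0# ⊞ identity x ⊠ constant 1#
        ≈⟨ solveᴶ (env 0# 0# (jetOf []) (jetOf []))
             (:constant :0 :⊞ :identity :x :⊠ :constant :1) (:identity :x)
             refl refl refl ⟩
      identity x ∎
      where open ≈ᴶ-Reasoning

    jetOf-⊖ : ∀ p q → jetOf (p ⊖ q) ≈ᴶ jetOf p ⊞ constant (- 1#) ⊠ jetOf q
    jetOf-⊖ p q = begin
      jetOf (p ⊖ q)
        ≈⟨ jetOf-⊕ p (map -_ q) ⟩
      jetOf p ⊞ jetOf (map -_ q)
        ≈⟨ ⊞-cong reflᴶ (jetOf-map (- 1#) -_ (λ y → sym (-1*x≈-x y)) q) ⟩
      jetOf p ⊞ constant (- 1#) ⊠ jetOf q ∎
      where open ≈ᴶ-Reasoning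

    jetOf-↑ : ∀ p n → jetOf (p ↑ n) ≈ᴶ jetOf p ^ᴶ n
    jetOf-↑ p zero    = jetOf-con 1#
    jetOf-↑ p (suc n) = begin
      jetOf (p ⊗ p ↑ n)         ≈⟨ jetOf-⊗ p (p ↑ n) ⟩
      jetOf p ⊠ jetOf (p ↑ n)   ≈⟨ ⊠-cong reflᴶ (jetOf-↑ p n) ⟩
      jetOf p ⊠ jetOf p ^ᴶ n    ∎
      where open ≈ᴶ-Reasoning

    ^ᴶ-cong : ∀ {p q} n → p ≈ᴶ q → p ^ᴶ n ≈ᴶ q ^ᴶ n
    ^ᴶ-cong zero    p≈q = reflᴶ
    ^ᴶ-cong (suc n) p≈q = ⊠-cong p≈q (^ᴶ-cong n p≈q)

    jetOf-con⊗X⊕con : ∀ k l →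
      jetOf (con k ⊗ X ⊕ con l) ≈ᴶ constant k ⊠ identity x ⊞ constant l
    jetOf-con⊗X⊕con k l = begin
      jetOf (con k ⊗ X ⊕ con l)
        ≈⟨ jetOf-⊕ (con k ⊗ X) (con l) ⟩
      jetOf (con k ⊗ X) ⊞ jetOf (con l)
        ≈⟨ ⊞-cong (jetOf-⊗ (con k) X) (jetOf-con l) ⟩
      jetOf (con k) ⊠ jetOf X ⊞ constant l
        ≈⟨ ⊞-cong (⊠-cong (jetOf-con k) jetOf-X) reflᴶ ⟩
      constant k ⊠ identity x ⊞ constant l ∎
      where open ≈ᴶ-Reasoning

    -- Turns `f` and the formal derivatives occurring in (iii) into explicit expressions that the
    -- solver can read.
    jetOf-f : ∀ a b n → jetOf (f a b n) ≈ᴶ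
      fᴶ (- 1#) (a (suc n) * a n + b (suc n)) (a (suc n) * b n)
         (a (n ∸ 1)) (b (n ∸ 1)) (a n) (b n) x
    jetOf-f a b n = begin
      jetOf (P ⊗ Q ⊗ X ↑ 6 ⊖ con (b (n ∸ 1)) ⊗ R ↑ 4)
        ≈⟨ jetOf-⊖ (P ⊗ Q ⊗ X ↑ 6) (con (b (n ∸ 1)) ⊗ R ↑ 4) ⟩
      jetOf (P ⊗ Q ⊗ X ↑ 6)
        ⊞ constant (- 1#) ⊠ jetOf (con (b (n ∸ 1)) ⊗ R ↑ 4)
        ≈⟨ ⊞-cong (jetOf-⊗ (P ⊗ Q) (X ↑ 6))
                  (⊠-cong reflᴶ (jetOf-⊗ (con (b (n ∸ 1))) (R ↑ 4))) ⟩
      jetOf (P ⊗ Q) ⊠ jetOf (X ↑ 6)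
        ⊞ constant (- 1#) ⊠ (jetOf (con (b (n ∸ 1))) ⊠ jetOf (R ↑ 4))
        ≈⟨ ⊞-cong
             (⊠-cong
               (transᴶ (jetOf-⊗ P Q)
                 (⊠-cong (jetOf-con⊗X⊕con _ _)
                   (transᴶ (jetOf-⊖ X (con (a (n ∸ 1))))
                     (⊞-cong jetOf-X (⊠-cong reflᴶ (jetOf-con _))))))
               (transᴶ (jetOf-↑ X 6) (^ᴶ-cong 6 jetOf-X)))
             (⊠-cong reflᴶ
               (⊠-cong (jetOf-con _)
                 (transᴶ (jetOf-↑ R 4) (^ᴶ-cong 4 (jetOf-con⊗X⊕con _ _))))) ⟩
      fᴶ (- 1#) (a (suc n) * a n + b (suc n)) (a (suc n) * b n)
         (a (n ∸ 1)) (b (n ∸ 1)) (a n) (b n) x ∎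
      where
      open ≈ᴶ-Reasoning
      P Q R : Polynomial
      P = con (a (suc n) * a n + b (suc n)) ⊗ X ⊕ con (a (suc n) * b n)
      Q = X ⊖ con (a (n ∸ 1))
      R = con (a n) ⊗ X ⊕ con (b n)

  -- Taylor expansion of f_n at r(n), and monotonicity to the right of it.

  open Exp semiring using (_^_; ^-congˡ)
  open TaylorCoefficients _+_ _*_ _^_ fromℕ

  module _ {n : ℕ} where
    open TaylorCoefficients {S = Expr n} _:+_ _:*_ _:^_ (_:× :1) public
      renaming (higherCoefficients to :higherCoefficients)

  :eval : ∀ {n} → List (Expr n) → Expr n → Expr n
  :eval []      x = :0
  :eval (k ∷ p) x = k :+ x :* :eval p x

  -- The second derivative enters with 10 / 2! = 5. The identity holds for every ε, without ε² = 1,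
  -- so it is within reach of a semiring solver.
  fᴶ-taylor : ∀ ε A C α β a b r t →
    let j = fᴶ ε A C α β a b r in
    fromℕ 10 * at₀ (fᴶ ε A C α β a b (r + t)) ≈
    eval (fromℕ 10 * at₀ j ∷ fromℕ 10 * at₁ j ∷ fromℕ 5 * at₂ j ∷
          higherCoefficients
            (fromℕ 8 * A * r + fromℕ 5 * (C + ε * α * A))
            A (ε * C * α) (ε * β) a (a * r + b) r) t
  fᴶ-taylor = solve 9
    (λ ε A C α β a b r t →
      let j = :fᴶ ε A C α β a b r in
      (10 :× :1) :* at₀ (:fᴶ ε A C α β a b (r :+ t)) :=
      :eval ((10 :× :1) :* at₀ j ∷ (10 :× :1) :* at₁ j ∷ (5 :× :1) :* at₂ j ∷
             :higherCoefficients
               ((8 :× :1) :* A :* r :+ (5 :× :1) :* (C :+ ε :* α :* A))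
               A (ε :* C :* α) (ε :* β) a (a :* r :+ b) r) t)
    refl

  eval-nonneg : ∀ {p t} → All (0# ≤_) p → 0# ≤ t → 0# ≤ eval p t
  eval-nonneg []          0≤t = ≤-reflexive refl
  eval-nonneg (0≤k ∷ 0≤p) 0≤t =
    +-nonneg 0≤k (*-nonneg 0≤t (eval-nonneg 0≤p 0≤t))

  mutual

    eval-mono-≤ : ∀ {p t w} → All (0# ≤_) p → 0# ≤ t → t ≤ w →
      eval p t ≤ eval p w
    eval-mono-≤ []        0≤t t≤w = ≤-reflexive refl
    eval-mono-≤ (_ ∷ 0≤p) 0≤t t≤w = eval-∷-mono-≤ _ 0≤p 0≤t t≤w

    -- The constant term k shifts both values alike, so it may have any sign. In the application it
    -- is 10 f(r), whose sign is unknown.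
    eval-∷-mono-≤ : ∀ k {p t w} → All (0# ≤_) p → 0# ≤ t → t ≤ w →
      eval (k ∷ p) t ≤ eval (k ∷ p) w
    eval-∷-mono-≤ k 0≤p 0≤t t≤w = +-monoʳ-≤ k (≤-trans
      -- The chain is t p(t) ≤ t p(w) ≤ w p(w).
      (*-monoʳ-≤ 0≤t (eval-mono-≤ 0≤p 0≤t t≤w))
      (*-monoˡ-≤ (eval-nonneg 0≤p (≤-trans 0≤t t≤w)) t≤w))

  -- The weights 8 and 5 in E are in the ratio 56 : 35 of the binomials "8 choose 3" and "7 choose
  -- 3", so E alone absorbs A and D at order 3; higher orders leave an extra nonnegative multiple of
  -- A. The proof term repeats the coefficients, with each operator reread as preservation of
  -- nonnegativity.
  higherCoefficients-nonneg : ∀ {E A G B a L r} →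
    0# ≤ E → 0# ≤ A → 0# ≤ G → 0# ≤ B → 0# ≤ a → 0# ≤ L → 0# ≤ r →
    All (0# ≤_) (higherCoefficients E A G B a L r)
  higherCoefficients-nonneg E A G B a L r =
    ν 70 ∙ r ↗ 4 ∙ E ⊹ ν 200 ∙ G ∙ r ↗ 3 ⊹ ν 40 ∙ B ∙ a ↗ 3 ∙ L ∷
    ν 70 ∙ r ↗ 3 ∙ (E ⊹ ν 2 ∙ A ∙ r) ⊹ ν 150 ∙ G ∙ r ↗ 2 ⊹ ν 10 ∙ B ∙ a ↗ 4 ∷
    ν 42 ∙ r ↗ 2 ∙ E ⊹ ν 224 ∙ A ∙ r ↗ 3 ⊹ ν 60 ∙ G ∙ r ∷
    ν 14 ∙ r ∙ E ⊹ ν 168 ∙ A ∙ r ↗ 2 ⊹ ν 10 ∙ G ∷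
    ν 2 ∙ E ⊹ ν 64 ∙ A ∙ r ∷
    ν 10 ∙ A ∷ []
    where
    infixl 6 _⊹_
    infixl 7 _∙_
    infixr 8 _↗_
    ν = fromℕ-nonneg
    _⊹_ : ∀ {x y} → 0# ≤ x → 0# ≤ y → 0# ≤ x + y
    _⊹_ = +-nonneg
    _∙_ : ∀ {x y} → 0# ≤ x → 0# ≤ y → 0# ≤ x * y
    _∙_ = *-nonneg
    _↗_ : ∀ {x} → 0# ≤ x → ∀ n → 0# ≤ x ^ n
    0≤x ↗ n = ^-nonneg n 0≤x

  module _ (a b : ℕ → Carrier) (n : ℕ) where

    private
      A C α β : Carrier
      A = a (suc n) * a n + b (suc n)
      C = a (suc n) * b n
      α = a (n ∸ 1)
      β = b (n ∸ 1)

    -- Ten times f at x is a polynomial in t = x - r whose nonconstant coefficients are all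
    -- nonnegative, and 0 ≤ u - r ≤ s - r.
    f-mono-≤ : ∀ {r} →
      0# < α → β < 0# → 0# < a n → b n < 0# → 0# < a (suc n) → 0# < A →
      0# ≤ fromℕ 8 * A * r
           + fromℕ 5 * (C - α * a (suc n) * a n - α * b (suc n)) →
      0# ≤ a n * r + b n →
      0# < eval (f a b n ′ ′) r →
      0# < eval (f a b n ′) r →
      ∀ {u s} → r ≤ u → u ≤ s → eval (f a b n) u ≤ eval (f a b n) s
    f-mono-≤ {r} 0<α β<0 0<a b<0 0<a⁺ 0<A 0≤E 0≤ar+b 0<f″ 0<f′ {u} {s} r≤u u≤s =
      -- `fromℕ-pos` is off by one: the argument 9 gives positivity of 10.
      *-cancelˡ-≤ (fromℕ-pos 9)
        (≤-respˡ-≈ (sym (10f≈ u)) (≤-respʳ-≈ (sym (10f≈ s))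
          (eval-∷-mono-≤ (fromℕ 10 * at₀ j) 0≤coefficients
            (x≤y⇒0≤y-x r≤u) (+-monoˡ-≤ (- r) u≤s))))
      where
      open _≈ᴶ_

      ε : Carrier
      ε = - 1#

      j : Jet Carrier
      j = fᴶ ε A C α β (a n) (b n) r

      E : Carrier
      E = fromℕ 8 * A * r + fromℕ 5 * (C + ε * α * A)

      coefficients : Polynomial
      coefficients = fromℕ 10 * at₁ j ∷ fromℕ 5 * at₂ j ∷
        higherCoefficients E A (ε * C * α) (ε * β) (a n) (a n * r + b n) r

      ε-pos : ∀ {x} → x < 0# → 0# < ε * x
      ε-pos {x} x<0 = <-respʳ-≈ (sym (-1*x≈-x x)) (neg-pos x<0)

      -- A negative r would make a_n r + b_n a sum of two negative numbers, against (ii).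
      0≤r : 0# ≤ r
      0≤r r<0 = 0≤ar+b (<-trans
        (<-respʳ-≈ (+-identityˡ (b n)) (+-monoˡ-< (b n) (*-pos-neg 0<a r<0)))
        b<0)

      -- Condition (ii) has the product α A multiplied out; here it is collected again to match the
      -- Taylor coefficients.
      D≈ : C - α * a (suc n) * a n - α * b (suc n) ≈ C + ε * α * A
      D≈ = begin
        C - α * a (suc n) * a n - α * b (suc n)
          ≈⟨ +-cong (+-congˡ (-1*x≈-x _)) (-1*x≈-x _) ⟨
        C + ε * (α * a (suc n) * a n) + ε * (α * b (suc n))
          ≈⟨ solve 6 (λ ε C α a⁺ a b⁺ →
               C :+ ε :* (α :* a⁺ :* a) :+ ε :* (α :* b⁺) :=
               C :+ ε :* α :* (a⁺ :* a :+ b⁺))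
             refl ε C α (a (suc n)) (a n) (b (suc n)) ⟩
        C + ε * α * A ∎
        where open ≈-Reasoning setoid

      0≤coefficients : All (0# ≤_) coefficients
      0≤coefficients =
        <⇒≤ (*-pos (fromℕ-pos 9) (<-respʳ-≈ (≈₁ (jetOf-f r a b n)) 0<f′)) ∷
        <⇒≤ (*-pos (fromℕ-pos 4) (<-respʳ-≈ (≈₂ (jetOf-f r a b n)) 0<f″)) ∷
        higherCoefficients-nonneg
          (≤-respʳ-≈ (+-congˡ (*-congˡ D≈)) 0≤E)
          (<⇒≤ 0<A)
          (<⇒≤ (*-pos (ε-pos (*-pos-neg 0<a⁺ b<0)) 0<α))
          (<⇒≤ (ε-pos β<0))
          (<⇒≤ 0<a)
          0≤ar+b
          0≤r

      10f≈ : ∀ x → fromℕ 10 * eval (f a b n) x ≈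
                   eval (fromℕ 10 * at₀ j ∷ coefficients) (x - r)
      10f≈ x = begin
        fromℕ 10 * eval (f a b n) x
          ≈⟨ *-congˡ (eval-congʳ (f a b n)
             (trans (+-comm r (x - r)) (x-y+y≈x x r))) ⟨
        fromℕ 10 * eval (f a b n) (r + (x - r))
          ≈⟨ *-congˡ (≈₀ (jetOf-f (r + (x - r)) a b n)) ⟩
        fromℕ 10 * at₀ (fᴶ ε A C α β (a n) (b n) (r + (x - r)))
          ≈⟨ fᴶ-taylor ε A C α β (a n) (b n) r (x - r) ⟩
        eval (fromℕ 10 * at₀ j ∷ coefficients) (x - r) ∎
        where open ≈-Reasoning setoid

    -- The recurrence on four consecutive ratios, and its link with f_n.

    module _ {v u p q : Carrier}
      (uv≈ : u * v ≈ α * v + β)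
      (pu≈ : p * u ≈ a n * u + b n)
      (qp≈ : q * p ≈ a (suc n) * p + b (suc n))
      where

      private
        ε : Carrier
        ε = - 1#

      -- Two steps of the recurrence give z_{n+2} = A z_n + C z_{n-1}; both sides here are z_{n+2} /
      -- z_{n-1}.
      A*u+C≈ : A * u + C ≈ q * p * u
      A*u+C≈ = begin
        A * u + C
          ≈⟨ solve 5 (λ a⁺ a b⁺ b u →
               (a⁺ :* a :+ b⁺) :* u :+ a⁺ :* b :=
               a⁺ :* (a :* u :+ b) :+ b⁺ :* u)
             refl (a (suc n)) (a n) (b (suc n)) (b n) u ⟩
        a (suc n) * (a n * u + b n) + b (suc n) * u
          ≈⟨ +-congʳ (*-congˡ pu≈) ⟨
        a (suc n) * (p * u) + b (suc n) * u
          ≈⟨ solve 4 (λ a⁺ b⁺ p u →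
               a⁺ :* (p :* u) :+ b⁺ :* u := (a⁺ :* p :+ b⁺) :* u)
             refl (a (suc n)) (b (suc n)) p u ⟩
        (a (suc n) * p + b (suc n)) * u
          ≈⟨ *-congʳ qp≈ ⟨
        q * p * u ∎
        where open ≈-Reasoning setoid

      -- This is (u - α) v = β, the reason for multiplying f(u) by v: the factor x - α of f becomes
      -- β.
      uv-αv≈β : u * v + ε * (α * v) ≈ β
      uv-αv≈β = begin
        u * v + ε * (α * v)    ≈⟨ +-cong (trans uv≈ (+-comm _ _)) (-1*x≈-x _) ⟩
        β + α * v - α * v      ≈⟨ x+y-y≈x β (α * v) ⟩
        β                      ∎
        where open ≈-Reasoning setoid

      -- At u the linear factors become products of ratios, A u + C = q p u and a u + b = p u. With
      -- (u - α) v = β, both summands then contain β p u⁴.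
      f*v≈ : eval (f a b n) u * v ≈ β * (p * u ^ 4 * (q * u ^ 3 - p ^ 3 * v))
      f*v≈ = begin
        eval (f a b n) u * v
          ≈⟨ *-congʳ (_≈ᴶ_.≈₀ (jetOf-f u a b n)) ⟩
        ((A * u + C) * (u + ε * α) * u ^ 6 + ε * (β * (a n * u + b n) ^ 4)) * v
          ≈⟨ *-congʳ (+-cong (*-congʳ (*-congʳ A*u+C≈))
                             (*-congˡ (*-congˡ (^-congˡ 4 (sym pu≈))))) ⟩
        (q * p * u * (u + ε * α) * u ^ 6 + ε * (β * (p * u) ^ 4)) * v
          ≈⟨ solve 7 (λ ε α β v u p q →
               (q :* p :* u :* (u :+ ε :* α) :* u :^ 6
                 :+ ε :* (β :* (p :* u) :^ 4)) :* v :=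
               q :* p :* u :^ 7 :* (u :* v :+ ε :* (α :* v))
                 :+ ε :* (β :* (p :* u) :^ 4 :* v))
             refl ε α β v u p q ⟩
        q * p * u ^ 7 * (u * v + ε * (α * v)) + ε * (β * (p * u) ^ 4 * v)
          ≈⟨ +-congʳ (*-congˡ uv-αv≈β) ⟩
        q * p * u ^ 7 * β + ε * (β * (p * u) ^ 4 * v)
          ≈⟨ solve 6 (λ ε β v u p q →
               q :* p :* u :^ 7 :* β :+ ε :* (β :* (p :* u) :^ 4 :* v) :=
               β :* (p :* u :^ 4 :* (q :* u :^ 3 :+ ε :* (p :^ 3 :* v))))
             refl ε β v u p q ⟩
        β * (p * u ^ 4 * (q * u ^ 3 + ε * (p ^ 3 * v)))
          ≈⟨ *-congˡ (*-congˡ (+-congˡ (-1*x≈-x _))) ⟩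
        β * (p * u ^ 4 * (q * u ^ 3 - p ^ 3 * v)) ∎
        where open ≈-Reasoning setoid

      -- If q u³ < p³ v, the factorisation makes f(u) v a product of two negative numbers, hence
      -- positive, whereas f(u) ≤ 0 < v gives f(u) v ≤ 0.
      f≤0⇒p³v≤qu³ : β < 0# → 0# < v → 0# < u → 0# < p →
        eval (f a b n) u ≤ 0# → p ^ 3 * v ≤ q * u ^ 3
      f≤0⇒p³v≤qu³ β<0 0<v 0<u 0<p f≤0 qu³<p³v =
        ≤-respʳ-≈ (zeroˡ v) (*-monoˡ-≤ (<⇒≤ 0<v) f≤0)
          (<-respʳ-≈ (sym f*v≈)
            (*-neg-neg β<0
              (*-pos-neg (*-pos 0<p (^-pos 4 0<u)) (x<y⇒x-y<0 qu³<p³v))))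

-- Quotients of positive numbers and log-convexity of ratios.

module RatioSequences {c ℓ₁ ℓ₂} (ℝ : RealNumbers c ℓ₁ ℓ₂) where

  open RealNumbers ℝ
  open Reals ℝ
  open OrderedFieldProperties orderedField
  open CommutativeRing commutativeRing using (commutativeSemiring; semiring)
  open Exp semiring using (_^_)
  open SemiringSolver commutativeSemiring
    using (solve; _:=_; _:+_; _:*_; _:^_)
  open ≈-Reasoning setoid

  _⁻¹ : ℝ⁺ → Carrier
  x ⁻¹ = proj₁ (inverse (val x) (pos x))

  *-inverseʳ : ∀ x → val x * x ⁻¹ ≈ 1#
  *-inverseʳ x = proj₂ (inverse (val x) (pos x))

  ÷-*-cancel : ∀ x y → val (x ÷ y) * val y ≈ val x
  ÷-*-cancel x y = begin
    val x * y ⁻¹ * val y    ≈⟨ *-assoc _ _ _ ⟩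
    val x * (y ⁻¹ * val y)  ≈⟨ *-congˡ (trans (*-comm _ _) (*-inverseʳ y)) ⟩
    val x * 1#              ≈⟨ *-identityʳ _ ⟩
    val x                   ∎

  -- In (z/y)(y/x) the y cancels, leaving z/x, which is the recurrence divided by x.
  ratio-recurrence : ∀ {a b} x y z → val z ≈ a * val y + b * val x →
    val (z ÷ y) * val (y ÷ x) ≈ a * val (y ÷ x) + b
  ratio-recurrence {a} {b} x y z z≈ = begin
    val z * y ⁻¹ * (val y * x ⁻¹)
      ≈⟨ solve 4 (λ z y y⁻¹ x⁻¹ →
           z :* y⁻¹ :* (y :* x⁻¹) := z :* x⁻¹ :* (y :* y⁻¹))
         refl (val z) (val y) (y ⁻¹) (x ⁻¹) ⟩
    val z * x ⁻¹ * (val y * y ⁻¹)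
      ≈⟨ *-cong (*-congʳ z≈) (*-inverseʳ y) ⟩
    (a * val y + b * val x) * x ⁻¹ * 1#
      ≈⟨ *-identityʳ _ ⟩
    (a * val y + b * val x) * x ⁻¹
      ≈⟨ solve 5 (λ a b y x x⁻¹ →
           (a :* y :+ b :* x) :* x⁻¹ := a :* (y :* x⁻¹) :+ b :* (x :* x⁻¹))
         refl a b (val y) (val x) (x ⁻¹) ⟩
    a * (val y * x ⁻¹) + b * (val x * x ⁻¹)
      ≈⟨ +-congˡ (trans (*-congˡ (*-inverseʳ x)) (*-identityʳ b)) ⟩
    a * (val y * x ⁻¹) + b ∎

  -- Both sides are multiplied by the positive common denominator u² v p, which is cancelled at the
  -- end.
  p³v≤qu³⇒log-convex : ∀ v u p q →
    val p ^ 3 * val v ≤ val q * val u ^ 3 →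
    val (p ÷ u) * val (p ÷ u) ≤ val (u ÷ v) * val (q ÷ p)
  p³v≤qu³⇒log-convex v u p q p³v≤qu³ =
    *-cancelʳ-≤ (*-pos (*-pos (pos u) (pos u)) (*-pos (pos v) (pos p)))
      (≤-respˡ-≈ (sym lhs) (≤-respʳ-≈ (sym rhs) p³v≤qu³))
    where
    lhs : val (p ÷ u) * val (p ÷ u) * (val u * val u * (val v * val p)) ≈
          val p ^ 3 * val v
    lhs = begin
      val (p ÷ u) * val (p ÷ u) * (val u * val u * (val v * val p))
        ≈⟨ solve 4 (λ p/u u v p →
             p/u :* p/u :* (u :* u :* (v :* p)) :=
             (p/u :* u) :* (p/u :* u) :* (v :* p))
           refl (val (p ÷ u)) (val u) (val v) (val p) ⟩
      val (p ÷ u) * val u * (val (p ÷ u) * val u) * (val v * val p)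
        ≈⟨ *-congʳ (*-cong (÷-*-cancel p u) (÷-*-cancel p u)) ⟩
      val p * val p * (val v * val p)
        ≈⟨ solve 2 (λ v p → p :* p :* (v :* p) := p :^ 3 :* v)
           refl (val v) (val p) ⟩
      val p ^ 3 * val v ∎

    rhs : val (u ÷ v) * val (q ÷ p) * (val u * val u * (val v * val p)) ≈
          val q * val u ^ 3
    rhs = begin
      val (u ÷ v) * val (q ÷ p) * (val u * val u * (val v * val p))
        ≈⟨ solve 5 (λ u/v q/p u v p →
             u/v :* q/p :* (u :* u :* (v :* p)) :=
             (u/v :* v) :* (q/p :* p) :* (u :* u))
           refl (val (u ÷ v)) (val (q ÷ p)) (val u) (val v) (val p) ⟩
      val (u ÷ v) * val v * (val (q ÷ p) * val p) * (val u * val u)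
        ≈⟨ *-congʳ (*-cong (÷-*-cancel u v) (÷-*-cancel q p)) ⟩
      val u * val q * (val u * val u)
        ≈⟨ solve 2 (λ u q → u :* q :* (u :* u) := q :* u :^ 3)
           refl (val u) (val q) ⟩
      val q * val u ^ 3 ∎

  ratioLogConvex-from : ∀ N x →
    (∀ m → N ℕ.≤ m →
      val (x (2 ℕ.+ m)) ^ 3 * val (x m) ≤
      val (x (3 ℕ.+ m)) * val (x (1 ℕ.+ m)) ^ 3) →
    RatioLogConvex (from N x)
  ratioLogConvex-from N x h (suc k) _
    -- Addition recurses on N, so successors must be moved out of the second summand before the
    -- indices take the form m, ..., m + 3.
    rewrite ℕ.+-suc N (suc (suc k)) | ℕ.+-suc N (suc k) | ℕ.+-suc N k =
    p³v≤qu³⇒log-convex (x m) (x (1 ℕ.+ m)) (x (2 ℕ.+ m)) (x (3 ℕ.+ m))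
      (h m (ℕ.m≤m+n N k))
    where m = N ℕ.+ k

theorem2p11 : ∀ {c ℓ₁ ℓ₂} (ℝ : RealNumbers c ℓ₁ ℓ₂) →
  let open RealNumbers ℝ
      open Reals ℝ
  in
  (z : ℕ → ℝ⁺) (a b : ℕ → Carrier) →
  (∀ n → 1 ℕ.≤ n →
    val (z (suc n)) ≈ a n * val (z n) + b n * val (z (n ∸ 1))) →
  (∀ n → 1 ℕ.≤ n → 0# < a n) →
  (∀ n → 1 ℕ.≤ n → b n < 0#) →
  (∀ n → 1 ℕ.≤ n → 0# < a (suc n) * a n + b (suc n)) →
  (r s : ℕ → Carrier) (N : ℕ) → 1 ℕ.≤ N →
  (∀ n → N ℕ.≤ n → r n ≤ val (z n ÷ z (n ∸ 1))) →
  (∀ n → N ℕ.≤ n → val (z n ÷ z (n ∸ 1)) ≤ s n) →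
  (∀ n → N ℕ.≤ n → s n ≤ a n) →
  (∀ n → N ℕ.≤ n →
    0# ≤ fromℕ 8 * (a (suc n) * a n + b (suc n)) * r n
         + fromℕ 5 * (a (suc n) * b n - a (n ∸ 1) * a (suc n) * a n
                      - a (n ∸ 1) * b (suc n))) →
  (∀ n → N ℕ.≤ n → 0# ≤ a n * r n + b n) →
  (∀ n → N ℕ.≤ n → 0# < eval (f a b n ′ ′) (r n)) →
  (∀ n → N ℕ.≤ n → 0# < eval (f a b n ′) (r n)) →
  (∀ n → N ℕ.≤ n → eval (f a b n) (s n) < 0#) →
  RatioLogConvex (from N (ratios z))
theorem2p11 ℝ z a b rec a>0 b<0 A>0 r s N 1≤N r≤ ≤s s≤a 0≤E 0≤ar+b 0<f″ 0<f′ f<0 =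
  ratioLogConvex-from N x λ m N≤m →
    -- The ratio z_n / z_{n-1} is the second of the four starting at x_m = z_{m+1} / z_m, whence n =
    -- m + 2. So n - 1 = m + 1 ≥ 1, where the signs of a and b are known.
    let n = 2 ℕ.+ m
        N≤n = ℕ.m≤n⇒m≤o+n 2 N≤m
    in f≤0⇒p³v≤qu³ a b n
      (ratio-recurrence (z m) (z (1 ℕ.+ m)) (z n) (rec (1 ℕ.+ m) 1≤1+n))
      (ratio-recurrence (z (1 ℕ.+ m)) (z n) (z (1 ℕ.+ n)) (rec n 1≤1+n))
      (ratio-recurrence (z n) (z (1 ℕ.+ n)) (z (2 ℕ.+ n)) (rec (1 ℕ.+ n) 1≤1+n))
      (b<0 (1 ℕ.+ m) 1≤1+n)
      (pos (x m)) (pos (x (1 ℕ.+ m))) (pos (x n))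
      (≤-trans
        (f-mono-≤ a b n
          (a>0 (1 ℕ.+ m) 1≤1+n) (b<0 (1 ℕ.+ m) 1≤1+n)
          (a>0 n 1≤1+n) (b<0 n 1≤1+n) (a>0 (1 ℕ.+ n) 1≤1+n) (A>0 n 1≤1+n)
          (0≤E n N≤n) (0≤ar+b n N≤n) (0<f″ n N≤n) (0<f′ n N≤n)
          (r≤ n N≤n) (≤s n N≤n))
        (<⇒≤ (f<0 n N≤n)))
  where
  open RealNumbers ℝ using (orderedField)
  open Reals ℝ
  open OrderedFieldProperties orderedField
  open Derivatives ℝ
  open RatioSequences ℝ

  x : ℕ → ℝ⁺
  x = ratios z

  1≤1+n : ∀ {n} → 1 ℕ.≤ suc n
  1≤1+n = ℕ.s≤s ℕ.z≤n
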